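{- Let $L$ be a language of algebras, let $\mathfrak A,\mathfrak B$ be $L$-algebras with universes $A,B$, and let $H:\mathfrak A\to\mathfrak B$ be a homomorphism. (1) Let $a,b\in A$ and suppose that: if every element of $\uparrow_{\mathfrak A}(a\to b)$ is trivial in $(\mathfrak A,\mathfrak B)$, then every element of $\uparrow_{\mathfrak B}(Ha\to Hb)$ is trivial in $(\mathfrak A,\mathfrak B)$. Then $a\to b\lesssim_{(\mathfrak A,\mathfrak B)}Ha\to Hb$. (2) If $H$ is an isomorphism, then $a:b\approx_{(\mathfrak A,\mathfrak B)}Ha:Hb$ for all $a,b\in A$.
   Context: Let $L$ be a language of algebras: a set of function symbols, each with an arity in $\mathbb N$ (constants are 0-ary function symbols). Fix a countably infinite set $X$ of variables; $T_{L,X}$ is the set of $L$-terms over $X$, and $X(s)$ denotes the set of variables occurring in a term $s$. For an $L$-algebra $\mathfrak A$ with universe $A$, every term $s$ induces a function $s^{\mathfrak A}$, evaluated at assignments of elements of $A$ to variables. A homomorphism $H:\mathfrak A\to\mathfrak B$ is a map $A\to B$ commuting with all function symbols of $L$; an isomorphism is a bijective homomorphism. An arrow of $\mathfrak A$ is a pair $(a,b)\in A\times A$, written $a\to b$. The generalizations of an arrow $a\to b$ in $\mathfrak A$ are the pairs of arbitrary terms $s\to t$ with $s,t\in T_{L,X}$ such that there is an assignment $\sigma$ of elements of $A$ to the variables in $X(s)\cup X(t)$ with $s^{\mathfrak A}(\sigma)=a$ and $t^{\mathfrak A}(\sigma)=b$; their set is denoted $\uparrow_{\mathfrak A}(a\to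 b)$. For $L$-algebras $\mathfrak A,\mathfrak B$, an arrow $a\to b$ of $\mathfrak A$ and an arrow $c\to d$ of $\mathfrak B$, set $(a\to b)\uparrow_{(\mathfrak A,\mathfrak B)}(c\to d):=\uparrow_{\mathfrak A}(a\to b)\cap\uparrow_{\mathfrak B}(c\to d)$. A pair of terms $s\to t$ is trivial in $(\mathfrak A,\mathfrak B)$ if it belongs to $\uparrow_{\mathfrak A}(e)$ for every arrow $e$ of $\mathfrak A$ and to $\uparrow_{\mathfrak B}(e')$ for every arrow $e'$ of $\mathfrak B$. We write $a\to b\lesssim_{(\mathfrak A,\mathfrak B)}c\to d$ iff either (i) every element of $\uparrow_{\mathfrak A}(a\to b)\cup\uparrow_{\mathfrak B}(c\to d)$ is trivial in $(\mathfrak A,\mathfrak B)$, or (ii) $(a\to b)\uparrow_{(\mathfrak A,\mathfrak B)}(c\to d)$ contains an element not trivial in $(\mathfrak A,\mathfrak B)$ and, for every arrow $c'\to d'$ of $\mathfrak B$, the inclusion $(a\to b)\uparrow_{(\mathfrak A,\mathfrak B)}(c\to d)\subseteq(a\to b)\uparrow_{(\mathfrak A,\mathfrak B)}(c'\to d')$ implies equality of these two sets. Define $a\to b\approx_{(\mathfrak A,\mathfrak B)}c\to d$ iff $a\to b\lesssim_{(\mathfrak A,\mathfrak B)}c\to d$ and $c\to d\lesssim_{(\mathfrak B,\mathfrak A)}a\to b$. For $a,b\in A$ and $c,d\in B$, the similarity-based analogical proportion $a:b\approx_{(\mathfrak A,\mathfrak B)}c:d$ holds iff $a\to b\approx_{(\mathfrak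 A,\mathfrak B)}c\to d$ and $b\to a\approx_{(\mathfrak A,\mathfrak B)}d\to c$. We write $\approx_{\mathfrak A}$ for $\approx_{(\mathfrak A,\mathfrak A)}$. -}

module Defs where

open import Data.Nat using (ℕ)
open import Data.Product using (Σ-syntax; _×_; _,_)
open import Data.Sum using (_⊎_; inj₁; inj₂)
open import Data.Vec using (Vec; []; _∷_; map)
open import Data.Vec.Relation.Unary.Any using (Any; here; there)
open import Function.Definitions using (Bijective)
open import Level using (Level; suc; _⊔_)
open import Relation.Binary.PropositionalEquality using (_≡_)
open import Relation.Unary using (Pred; _∈_; _⊆_; _≐_; _∩_; _∪_; ∁; Satisfiable)

record Language (o : Level) : Set (suc o) where
  field
    Symbol : Set o
    arity  : Symbol → ℕ

open Language public

record Algebra {o} (L : Language o) (a : Level) : Set (o ⊔ suc a) where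
  field
    Carrier : Set a
    ⟦_⟧     : (f : Symbol L) → Vec Carrier (arity L f) → Carrier

open Algebra public using (Carrier)

module _ {o a b} {L : Language o} (𝔄 : Algebra L a) (𝔅 : Algebra L b) where

  private
    module 𝔄 = Algebra 𝔄
    module 𝔅 = Algebra 𝔅

  IsHomomorphism : (Carrier 𝔄 → Carrier 𝔅) → Set (o ⊔ a ⊔ b)
  IsHomomorphism H = ∀ f xs → H (𝔄.⟦ f ⟧ xs) ≡ 𝔅.⟦ f ⟧ (map H xs)

  IsIsomorphism : (Carrier 𝔄 → Carrier 𝔅) → Set (o ⊔ a ⊔ b)
  IsIsomorphism H = IsHomomorphism H × Bijective _≡_ _≡_ H

Arrow : ∀ {a} → Set a → Set a
Arrow A = A × A

infix 5 _⟶_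
pattern _⟶_ x y = x , y

module Terms {o} (L : Language o) (X : Set) where

  data Term : Set o where
    var : X → Term
    op  : (f : Symbol L) → Vec Term (arity L f) → Term

  data Occurs (x : X) : Term → Set o where
    var-occ : Occurs x (var x)
    op-occ  : ∀ {f ts} → Any (Occurs x) ts → Occurs x (op f ts)

  Vars : Term → Pred X o
  Vars s x = Occurs x s

  -- Irrelevance of the membership proof makes an assignment a function on the
  -- subset V, even when a variable occurs several times in a term.
  Assignment : ∀ {v a} → Pred X v → Set a → Set (v ⊔ a)
  Assignment V A = (x : X) → .(x ∈ V) → A

  module _ {a} (𝔄 : Algebra L a) where

    open Algebra 𝔄 using (⟦_⟧)

    eval  : (s : Term) → Assignment (Vars s) (Carrier 𝔄) → Carrier 𝔄
    evals : ∀ {n} (ts : Vec Term n) →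
            Assignment (λ x → Any (Occurs x) ts) (Carrier 𝔄) → Vec (Carrier 𝔄) n

    eval (var x)   σ = σ x var-occ
    eval (op f ts) σ = ⟦ f ⟧ (evals ts (λ x p → σ x (op-occ p)))

    evals []       σ = []
    evals (t ∷ ts) σ = eval t (λ x p → σ x (here p)) ∷ evals ts (λ x p → σ x (there p))

    ↑ : Arrow (Carrier 𝔄) → Pred (Arrow Term) (o ⊔ a)
    ↑ (a ⟶ b) (s ⟶ t) =
      Σ[ σ ∈ Assignment (Vars s ∪ Vars t) (Carrier 𝔄) ]
        eval s (λ x p → σ x (inj₁ p)) ≡ a × eval t (λ x p → σ x (inj₂ p)) ≡ b

  module _ {a b} (𝔄 : Algebra L a) (𝔅 : Algebra L b) where

    common : Arrow (Carrier 𝔄) → Arrow (Carrier 𝔅) → Pred (Arrow Term) (o ⊔ a ⊔ b)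
    common e e′ = ↑ 𝔄 e ∩ ↑ 𝔅 e′

    Trivial : Pred (Arrow Term) (o ⊔ a ⊔ b)
    Trivial p = (∀ e → p ∈ ↑ 𝔄 e) × (∀ e′ → p ∈ ↑ 𝔅 e′)

    Lesssim : Arrow (Carrier 𝔄) → Arrow (Carrier 𝔅) → Set (o ⊔ a ⊔ b)
    Lesssim e e′ =
      (↑ 𝔄 e ∪ ↑ 𝔅 e′) ⊆ Trivial
      ⊎ (Satisfiable (common e e′ ∩ ∁ Trivial)
         × (∀ e″ → common e e′ ⊆ common e e″ → common e e′ ≐ common e e″))

    syntax Lesssim 𝔄 𝔅 e e′ = e ≲[ 𝔄 ∣ 𝔅 ] e′

  module _ {ℓ₁ ℓ₂} (𝔄 : Algebra L ℓ₁) (𝔅 : Algebra L ℓ₂) where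

    Approx : Arrow (Carrier 𝔄) → Arrow (Carrier 𝔅) → Set (o ⊔ ℓ₁ ⊔ ℓ₂)
    Approx e e′ = (e ≲[ 𝔄 ∣ 𝔅 ] e′) × (e′ ≲[ 𝔅 ∣ 𝔄 ] e)

    syntax Approx 𝔄 𝔅 e e′ = e ≈[ 𝔄 ∣ 𝔅 ] e′

  module _ {ℓ₁ ℓ₂} (𝔄 : Algebra L ℓ₁) (𝔅 : Algebra L ℓ₂) where

    Proportion : (a b : Carrier 𝔄) (c d : Carrier 𝔅) → Set (o ⊔ ℓ₁ ⊔ ℓ₂)
    Proportion a b c d =
      ((a ⟶ b) ≈[ 𝔄 ∣ 𝔅 ] (c ⟶ d)) × ((b ⟶ a) ≈[ 𝔄 ∣ 𝔅 ] (d ⟶ c))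

    syntax Proportion 𝔄 𝔅 a b c d = a ∶ b ≈[ 𝔄 ∣ 𝔅 ] c ∶ d

{-# OPTIONS --safe #-}
module Submission where

-- A homomorphism H carries a witness of a generalization of e to a witness of
-- the same generalization of H e, so ↑ e ⊆ ↑ (H e). The common generalizations
-- of e and H e are then all of ↑ e, the largest set they could possibly be,
-- which makes maximality immediate. For an isomorphism the inverse gives the
-- opposite inclusion, so the same argument applies in both directions.

open import Axiom.ExcludedMiddle using (ExcludedMiddle)
open import Data.Nat using (ℕ)
open import Data.Product using (_×_; _,_; proj₁; proj₂)
open import Data.Sum using (inj₁; inj₂; [_,_])
open import Data.Vec using (Vec; []; _∷_; map)
open import Data.Vec.Properties using (map-cong; map-id; map-∘)
open import Function.Base using (id; _∘_)
open import Function.Bundles using (_↔_)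
open import Function.Consequences.Propositional using (surjective⇒strictlySurjective)
open import Function.Definitions using (Injective; StrictlyInverseˡ)
open import Level using (_⊔_)
open import Relation.Binary.PropositionalEquality using (_≡_; refl; sym; trans; cong; cong₂; subst₂; module ≡-Reasoning)
open import Relation.Nullary.Decidable using (yes; no; decidable-stable)
open import Relation.Unary using (_∈_; _⊆_)
open import Defs

-- By injectivity it suffices to compare the two sides after applying `H`, where `H ∘ G` cancels
-- both on the result and on every argument.
inverse-isHomomorphism :
  ∀ {o ℓ₁ ℓ₂} {L : Language o} (𝔄 : Algebra L ℓ₁) (𝔅 : Algebra L ℓ₂)
  {H : Carrier 𝔄 → Carrier 𝔅} {G : Carrier 𝔅 → Carrier 𝔄} →
  IsHomomorphism 𝔄 𝔅 H → Injective _≡_ _≡_ H → StrictlyInverseˡ _≡_ H G →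
  IsHomomorphism 𝔅 𝔄 G
inverse-isHomomorphism 𝔄 𝔅 {H} {G} hom inj HG f ys = inj (begin
  H (G (𝔅.⟦ f ⟧ ys))             ≡⟨ HG _ ⟩
  𝔅.⟦ f ⟧ ys                     ≡⟨ cong 𝔅.⟦ f ⟧ (map-id ys) ⟨
  𝔅.⟦ f ⟧ (map id ys)            ≡⟨ cong 𝔅.⟦ f ⟧ (map-cong HG ys) ⟨
  𝔅.⟦ f ⟧ (map (H ∘ G) ys)       ≡⟨ cong 𝔅.⟦ f ⟧ (map-∘ H G ys) ⟩
  𝔅.⟦ f ⟧ (map H (map G ys))     ≡⟨ hom f (map G ys) ⟨
  H (𝔄.⟦ f ⟧ (map G ys))         ∎)
  where
  open ≡-Reasoning
  module 𝔄 = Algebra 𝔄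
  module 𝔅 = Algebra 𝔅

module _ {o} {L : Language o} {X : Set} where

  open Terms L X

  module _ {ℓ₁ ℓ₂} (𝔄 : Algebra L ℓ₁) (𝔅 : Algebra L ℓ₂)
           {H : Carrier 𝔄 → Carrier 𝔅} (hom : IsHomomorphism 𝔄 𝔅 H) where

    eval-homo : ∀ s (σ : Assignment (Vars s) (Carrier 𝔄)) →
                H (eval 𝔄 s σ) ≡ eval 𝔅 s (λ x p → H (σ x p))
    evals-homo : ∀ {n} (ts : Vec Term n) σ →
                 map H (evals 𝔄 ts σ) ≡ evals 𝔅 ts (λ x p → H (σ x p))

    eval-homo (var x)   σ = refl
    eval-homo (op f ts) σ =
      trans (hom f _) (cong (Algebra.⟦_⟧ 𝔅 f) (evals-homo ts (λ x p → σ x (op-occ p))))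

    evals-homo []       σ = refl
    evals-homo (t ∷ ts) σ = cong₂ _∷_ (eval-homo t _) (evals-homo ts _)

    ↑-homo : ∀ a b → ↑ 𝔄 (a ⟶ b) ⊆ ↑ 𝔅 (H a ⟶ H b)
    ↑-homo a b {s ⟶ t} (σ , s≡a , t≡b) =
      (λ x p → H (σ x p)) ,
      trans (sym (eval-homo s _)) (cong H s≡a) ,
      trans (sym (eval-homo t _)) (cong H t≡b)

  -- Excluded middle decides whether a nontrivial common generalization exists, and the answer
  -- selects the clause of `≲` to be proved.
  ↑⊆↑⇒≲ : ∀ {ℓ₁ ℓ₂} → ExcludedMiddle (o ⊔ ℓ₁ ⊔ ℓ₂) →
           (𝔄 : Algebra L ℓ₁) (𝔅 : Algebra L ℓ₂) →
           ∀ e e′ → ↑ 𝔄 e ⊆ ↑ 𝔅 e′ →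
           (↑ 𝔄 e ⊆ Trivial 𝔄 𝔅 → ↑ 𝔅 e′ ⊆ Trivial 𝔄 𝔅) →
           e ≲[ 𝔄 ∣ 𝔅 ] e′
  ↑⊆↑⇒≲ em 𝔄 𝔅 e e′ e⊆e′ trivial with em
  -- For the reverse inclusion, membership in `↑ 𝔄 e` alone already yields membership in
  -- `common e e′`.
  ... | yes nontrivial = inj₂ (nontrivial , λ e″ ⊆e″ →
        (λ {p} → ⊆e″ {p}) , λ (p∈e , _) → p∈e , e⊆e′ p∈e)
  ... | no ¬nontrivial = inj₁ [ ↑e-trivial , trivial ↑e-trivial ]
    where
    ↑e-trivial : ↑ 𝔄 e ⊆ Trivial 𝔄 𝔅
    -- A nontrivial element of `↑ 𝔄 e` would also lie in `↑ 𝔅 e′`, and so be a nontrivial common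
    -- generalization.
    ↑e-trivial p∈e = decidable-stable em λ ¬triv →
      ¬nontrivial (_ , (p∈e , e⊆e′ p∈e) , ¬triv)

  -- With both inclusions available, triviality passes between the two sets in either direction.
  ↑≐↑⇒≈ : ∀ {ℓ₁ ℓ₂} → ExcludedMiddle (o ⊔ ℓ₁ ⊔ ℓ₂) →
           (𝔄 : Algebra L ℓ₁) (𝔅 : Algebra L ℓ₂) →
           ∀ e e′ → ↑ 𝔄 e ⊆ ↑ 𝔅 e′ → ↑ 𝔅 e′ ⊆ ↑ 𝔄 e → e ≈[ 𝔄 ∣ 𝔅 ] e′
  ↑≐↑⇒≈ em 𝔄 𝔅 e e′ e⊆e′ e′⊆e =
    ↑⊆↑⇒≲ em 𝔄 𝔅 e e′ e⊆e′ (λ triv p∈e′ → triv (e′⊆e p∈e′)) ,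
    ↑⊆↑⇒≲ em 𝔅 𝔄 e′ e e′⊆e (λ triv p∈e → triv (e⊆e′ p∈e))

  isomorphism⇒≈ : ∀ {ℓ₁ ℓ₂} → ExcludedMiddle (o ⊔ ℓ₁ ⊔ ℓ₂) →
                   (𝔄 : Algebra L ℓ₁) (𝔅 : Algebra L ℓ₂)
                   {H : Carrier 𝔄 → Carrier 𝔅} → IsIsomorphism 𝔄 𝔅 H →
                   ∀ a b → (a ⟶ b) ≈[ 𝔄 ∣ 𝔅 ] (H a ⟶ H b)
  isomorphism⇒≈ em 𝔄 𝔅 {H} (hom , inj , surj) a b =
    ↑≐↑⇒≈ em 𝔄 𝔅 _ _ (↑-homo 𝔄 𝔅 hom a b) λ {p} p∈He →
      -- Pushing `p` forward along the homomorphism `G` lands at `G (H a) ⟶ G (H b)`, which is then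
      -- identified with `a ⟶ b`.
      subst₂ (λ x y → p ∈ ↑ 𝔄 (x ⟶ y)) (GH a) (GH b)
        (↑-homo 𝔅 𝔄 (inverse-isHomomorphism 𝔄 𝔅 hom inj HG) (H a) (H b) p∈He)
    where
    G : Carrier 𝔅 → Carrier 𝔄
    G y = proj₁ (surjective⇒strictlySurjective surj y)

    HG : ∀ y → H (G y) ≡ y
    HG y = proj₂ (surjective⇒strictlySurjective surj y)

    GH : ∀ x → G (H x) ≡ x
    GH x = inj (HG (H x))

theorem7 : ∀ {o ℓ₁ ℓ₂} → ExcludedMiddle (o ⊔ ℓ₁ ⊔ ℓ₂) →
    (L : Language o) (X : Set) → X ↔ ℕ →
    (𝔄 : Algebra L ℓ₁) (𝔅 : Algebra L ℓ₂) (H : Carrier 𝔄 → Carrier 𝔅) → IsHomomorphism 𝔄 𝔅 H →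
    let open Terms L X in
    (∀ a b →
    (↑ 𝔄 (a ⟶ b) ⊆ Trivial 𝔄 𝔅 → ↑ 𝔅 (H a ⟶ H b) ⊆ Trivial 𝔄 𝔅) →
    (a ⟶ b) ≲[ 𝔄 ∣ 𝔅 ] (H a ⟶ H b))
    × (IsIsomorphism 𝔄 𝔅 H → ∀ a b → a ∶ b ≈[ 𝔄 ∣ 𝔅 ] H a ∶ H b)
theorem7 em L X _ 𝔄 𝔅 H hom =
  (λ a b → ↑⊆↑⇒≲ em 𝔄 𝔅 (a ⟶ b) (H a ⟶ H b) (↑-homo 𝔄 𝔅 hom a b)) ,
  -- The reversed arrows are the same result with `a` and `b` exchanged.
  (λ iso a b → isomorphism⇒≈ em 𝔄 𝔅 iso a b , isomorphism⇒≈ em 𝔄 𝔅 iso b a)
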